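{- Let $k\ge 12$ be an even integer and let $p\in W_k^+$. Define coefficients $b_{r,s}\in\mathbb{Q}$ (for integers $r,s\ge 1$ with $r+s=k+1$) by $$p(X+Y,Y)=\sum_{r+s=k+1}\binom{k-1}{r-1}\,b_{r,s}\,X^{r-1}Y^{s-2}.$$ (Since $p(X+Y,Y)$ is a polynomial, $b_{k,1}=0$.) Then in the formal double zeta space $\mathcal{D}_{k+1}$ one has $$\sum_{\substack{r+s=k+1\\ 4\le r\le k-2,\ r\text{ even}}}(b_{r,s}-b_{s,r})\,Z_{r,s}\equiv 0 \pmod{Z_{k+1}},$$ i.e. the left-hand side is a rational multiple of $Z_{k+1}$ in $\mathcal{D}_{k+1}$.
   Context: Formal double zeta space. For an integer $w>2$, $\mathcal{D}_w$ is the $\mathbb{Q}$-vector space generated by formal symbols $Z_{r,s}$, $P_{r,s}$ (for integers $r,s\ge 1$ with $r+s=w$) and $Z_w$, modulo the relations $$Z_{r,s}+Z_{s,r}=P_{r,s}-Z_w\quad (r+s=w,\ r,s\ge1),$$ $$\sum_{\substack{r+s=w\\ r,s\ge 1}}\left[\binom{r-1}{i-1}+\binom{r-1}{j-1}\right]Z_{r,s}=P_{i,j}\quad (i+j=w,\ i,j\ge1).$$ Period polynomials. For even $k$, $V_k$ is the $\mathbb{Q}$-vector space of homogeneous polynomials of degree $k-2$ in $X,Y$ with rational coefficients, and $W_k\subset V_k$ is the subspace of polynomials $P$ satisfying $P(X,Y)+P(-Y,X)=0$ and $P(X,Y)+P(X-Y,X)+P(Y,Y-X)=0$. Then $W_k=W_k^+\oplus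 W_k^-$, where $W_k^+$ (resp. $W_k^-$) is the subspace of polynomials that are symmetric, $P(X,Y)=P(Y,X)$ (resp. antisymmetric, $P(X,Y)=-P(Y,X)$). -}

module Defs where

open import Algebra.Module.Bundles using (Module)
open import Algebra.Module.Structures.Biased using (IsModuleFromLeft)
open import Data.Fin.Base using (Fin; toℕ; fromℕ<; opposite)
open import Data.Fin.Properties using (toℕ<n; toℕ-fromℕ<; opposite-prop)
open import Data.Integer.Base using (+_)
open import Data.Nat.Base as ℕ using (ℕ; zero; suc; _∸_; _≤_; s≤s)
open import Data.Nat.Combinatorics using (_C_)
import Data.Nat.Properties as ℕ
open import Data.Product.Base using (_×_; _,_; ∃-syntax)
open import Data.Rational.Base as ℚ using (ℚ; 0ℚ; 1ℚ; _+_; _*_; -_)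
open import Data.Rational.Properties using (+-*-commutativeRing; *-zeroʳ; +-inverseˡ; +-inverseʳ)
open import Data.Vec.Base using (Vec; []; _∷_; _∷ʳ_; map; zipWith; replicate)
open import Data.Vec.Functional using (Vector; foldr)
open import Level using (0ℓ)
open import Relation.Binary.PropositionalEquality
  using (_≡_; refl; sym; trans; cong; subst)

fromℕ : ℕ → ℚ
fromℕ n = + n ℚ./ 1

-- Homogeneous polynomials of degree d in X and Y over ℚ: the entry at position i is the coefficient of Xⁱ Yᵈ⁻ⁱ.
HPoly : ℕ → Set
HPoly d = Vec ℚ (suc d)

infixl 6 _+ₚ_ _-ₚ_
infixr 7 _·ₚ_ _*ₚ_
infix  8 -ₚ_
infixl 9 _⟨_,_⟩

0ₚ : ∀ {d} → HPoly d
0ₚ = replicate _ 0ℚ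

_+ₚ_ : ∀ {d} → HPoly d → HPoly d → HPoly d
_+ₚ_ = zipWith _+_

-ₚ_ : ∀ {d} → HPoly d → HPoly d
-ₚ_ = map (λ c → - c)

_-ₚ_ : ∀ {d} → HPoly d → HPoly d → HPoly d
p -ₚ q = p +ₚ (-ₚ q)

_·ₚ_ : ∀ {d} → ℚ → HPoly d → HPoly d
c ·ₚ p = map (c *_) p

LinearForm : Set
LinearForm = HPoly 1

X Y : LinearForm
X = 0ℚ ∷ 1ℚ ∷ []
Y = 1ℚ ∷ 0ℚ ∷ []

-- (a X + b Y) q, where X q is 0 ∷ q and Y q is q ∷ʳ 0.
_*ₚ_ : ∀ {d} → LinearForm → HPoly d → HPoly (suc d)
(b ∷ a ∷ []) *ₚ q = a ·ₚ (0ℚ ∷ q) +ₚ b ·ₚ (q ∷ʳ 0ℚ)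

_^ₚ_ : LinearForm → (d : ℕ) → HPoly d
L ^ₚ zero  = 1ℚ ∷ []
L ^ₚ suc d = L *ₚ (L ^ₚ d)

-- Substitution p(L, M), by Horner's scheme p = c Yᵈ⁺¹ + X q.
_⟨_,_⟩ : ∀ {d} → HPoly d → LinearForm → LinearForm → HPoly d
_⟨_,_⟩ {zero}  p       L M = p
_⟨_,_⟩ {suc d} (c ∷ q) L M = c ·ₚ (M ^ₚ suc d) +ₚ L *ₚ q ⟨ L , M ⟩

-- Meant for even k ≥ 2.
V : ℕ → Set
V k = HPoly (k ∸ 2)

record W (k : ℕ) (p : V k) : Set where
  field
    two-term   : p +ₚ p ⟨ -ₚ Y , X ⟩ ≡ 0ₚ
    three-term : p +ₚ p ⟨ X -ₚ Y , X ⟩ +ₚ p ⟨ Y , Y -ₚ X ⟩ ≡ 0ₚ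

record W⁺ (k : ℕ) (p : V k) : Set where
  field
    inW       : W k p
    symmetric : p ≡ p ⟨ Y , X ⟩

-- A pair of integers r, s ≥ 1 with r + s = w is encoded by r - 1, which ranges
-- over Fin (w - 1); the pair (s , r) is then encoded by the opposite element.
Index : ℕ → Set
Index w = Fin (w ∸ 1)

fst snd : ∀ {n} → Fin n → ℕ
fst i = suc (toℕ i)
snd i = fst (opposite i)

fst+snd : ∀ {n} (i : Fin n) → fst i ℕ.+ snd i ≡ suc n
fst+snd {n} i = cong suc (trans (ℕ.+-suc (toℕ i) _)
  (trans (cong (suc (toℕ i) ℕ.+_) (opposite-prop i)) (ℕ.m+[n∸m]≡n (toℕ<n i))))

index : ∀ {n r s} → 1 ≤ r → 1 ≤ s → r ℕ.+ s ≡ suc n →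
        ∃[ i ] fst {n} i ≡ r × snd i ≡ s
index {n} {suc r} {suc s} _ _ eq = i , fst-i ,
  ℕ.+-cancelˡ-≡ (suc r) _ _
    (trans (cong (ℕ._+ snd i) (sym fst-i)) (trans (fst+snd i) (sym eq)))
  where
  r<n : r ℕ.< n
  r<n = subst (r ℕ.<_) (ℕ.suc-injective eq) (ℕ.m<m+n r (s≤s ℕ.z≤n))

  i : Fin n
  i = fromℕ< r<n

  fst-i : fst i ≡ suc r
  fst-i = cong suc (toℕ-fromℕ< r<n)

infixl 6 _⊕_ _⊖_
infixr 7 _⊛_

data Term (G : Set) : Set where
  gen : G → Term G
  𝟘   : Term G
  _⊕_ : Term G → Term G → Term G
  _⊛_ : ℚ → Term G → Term G

_⊖_ : ∀ {G} → Term G → Term G → Term G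
x ⊖ y = x ⊕ (- 1ℚ) ⊛ y

∑ : ∀ {G n} → Vector (Term G) n → Term G
∑ = foldr _⊕_ 𝟘

-- The least congruence containing R for which Term G is a ℚ-vector space.
data Cong {G : Set} (R : Term G → Term G → Set) : Term G → Term G → Set where
  rel       : ∀ {x y} → R x y → Cong R x y
  ≈-refl    : ∀ {x} → Cong R x x
  ≈-sym     : ∀ {x y} → Cong R x y → Cong R y x
  ≈-trans   : ∀ {x y z} → Cong R x y → Cong R y z → Cong R x z
  ⊕-cong    : ∀ {x x′ y y′} → Cong R x x′ → Cong R y y′ → Cong R (x ⊕ y) (x′ ⊕ y′)
  ⊛-cong    : ∀ {x x′} c → Cong R x x′ → Cong R (c ⊛ x) (c ⊛ x′)
  ⊕-assoc   : ∀ x y z → Cong R ((x ⊕ y) ⊕ z) (x ⊕ (y ⊕ z))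
  ⊕-comm    : ∀ x y → Cong R (x ⊕ y) (y ⊕ x)
  ⊕-idˡ     : ∀ x → Cong R (𝟘 ⊕ x) x
  ⊛-zeroˡ   : ∀ x → Cong R (0ℚ ⊛ x) 𝟘
  ⊛-idˡ     : ∀ x → Cong R (1ℚ ⊛ x) x
  ⊛-assoc   : ∀ c d x → Cong R ((c * d) ⊛ x) (c ⊛ (d ⊛ x))
  ⊛-distribˡ : ∀ c x y → Cong R (c ⊛ (x ⊕ y)) (c ⊛ x ⊕ c ⊛ y)
  ⊛-distribʳ : ∀ x c d → Cong R ((c + d) ⊛ x) (c ⊛ x ⊕ d ⊛ x)

module _ {G : Set} (R : Term G → Term G → Set) where

  private
    ≡⇒≈ : ∀ {x y} → x ≡ y → Cong R x y
    ≡⇒≈ refl = ≈-refl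

    ⊛-zeroʳ : ∀ c → Cong R (c ⊛ 𝟘) 𝟘
    ⊛-zeroʳ c = ≈-trans (⊛-cong c (≈-sym (⊛-zeroˡ 𝟘)))
      (≈-trans (≈-sym (⊛-assoc c 0ℚ 𝟘))
      (≈-trans (≡⇒≈ (cong (_⊛ 𝟘) (*-zeroʳ c))) (⊛-zeroˡ 𝟘)))

    inverseˡ : ∀ x → Cong R ((- 1ℚ) ⊛ x ⊕ x) 𝟘
    inverseˡ x = ≈-trans (⊕-cong ≈-refl (≈-sym (⊛-idˡ x)))
      (≈-trans (≈-sym (⊛-distribʳ x (- 1ℚ) 1ℚ))
      (≈-trans (≡⇒≈ (cong (_⊛ x) (+-inverseˡ 1ℚ))) (⊛-zeroˡ x)))

    isModuleFromLeft : IsModuleFromLeft +-*-commutativeRing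
                         (Cong R) _⊕_ 𝟘 ((- 1ℚ) ⊛_) _⊛_
    isModuleFromLeft = record
      { isLeftModule = record
        { isLeftSemimodule = record
          { +ᴹ-isCommutativeMonoid = record
            { isMonoid = record
              { isSemigroup = record
                { isMagma = record
                  { isEquivalence = record
                    { refl = ≈-refl ; sym = ≈-sym ; trans = ≈-trans }
                  ; ∙-cong = ⊕-cong
                  }
                ; assoc = ⊕-assoc
                }
              ; identity = ⊕-idˡ , λ x → ≈-trans (⊕-comm x 𝟘) (⊕-idˡ x)
              }
            ; comm = ⊕-comm
            }
          ; isPreleftSemimodule = record
            { *ₗ-cong      = λ { {c} refl x≈y → ⊛-cong c x≈y }
            ; *ₗ-zeroˡ     = ⊛-zeroˡ
            ; *ₗ-distribʳ  = ⊛-distribʳ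
            ; *ₗ-identityˡ = ⊛-idˡ
            ; *ₗ-assoc     = ⊛-assoc
            ; *ₗ-zeroʳ     = ⊛-zeroʳ
            ; *ₗ-distribˡ  = ⊛-distribˡ
            }
          }
        ; -ᴹ‿cong    = ⊛-cong (- 1ℚ)
        ; -ᴹ‿inverse = inverseˡ , λ x → ≈-trans (⊕-comm x _) (inverseˡ x)
        }
      }

  presented : Module +-*-commutativeRing 0ℓ 0ℓ
  presented = record { isModule = IsModuleFromLeft.isModule isModuleFromLeft }

data Symbol (w : ℕ) : Set where
  Z-symbol P-symbol : Index w → Symbol w
  Zw-symbol         : Symbol w

-- The formal double zeta space of weight w, considered for w > 2.
module DoubleZeta (w : ℕ) where

  Z P : Index w → Term (Symbol w)
  Z i = gen (Z-symbol i)
  P i = gen (P-symbol i)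

  Zw : Term (Symbol w)
  Zw = gen Zw-symbol

  data Relation : Term (Symbol w) → Term (Symbol w) → Set where
    stuffle : ∀ i → Relation (Z i ⊕ Z (opposite i)) (P i ⊖ Zw)
    shuffle : ∀ i → Relation
      (∑ λ (ρ : Index w) →
        fromℕ ((fst ρ ∸ 1) C (fst i ∸ 1) ℕ.+ (fst ρ ∸ 1) C (snd i ∸ 1)) ⊛ Z ρ)
      (P i)

  𝓓 : Module +-*-commutativeRing 0ℓ 0ℓ
  𝓓 = presented Relation

  open Module 𝓓 public
    using (_≈ᴹ_; _+ᴹ_; _*ₗ_; 0ᴹ; -ᴹ_)

{-# OPTIONS --safe #-}
module Submission where

-- Put N = k - 1 and A(X,Y) = Y p(X+Y,Y) - X p(X+Y,X) = Σ C(N,n) aₙ Xⁿ Yᴺ⁻ⁿ, where aₙ = b(r,s) - b(s,r)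
-- for r = n + 1.  As p is symmetric and odd in each variable, the three-term relation reads
-- p(X,Y) = p(X+Y,Y) + p(X+Y,X), which gives A(-X,X+Y) = A(X,Y); on coefficients,
-- aₙ = Σᵢ C(n,i) (-1)ⁱ aᵢ.  Since N is odd, (-1)ⁱ aᵢ is invariant under i ↦ N - i, so the combination of
-- the double shuffle relations with these weights is Σₙ 2 (aₙ - (-1)ⁿ aₙ) Z ≡ 0 modulo the last generator,
-- and only the odd n (even r) survive.  The terms r = 2 and r = k drop out because p(1,1) = 0.

open import Defs
open import Algebra.Bundles using (CommutativeRing; RawRing)
open import Algebra.Module.Bundles using (Module)
open import Data.Bool.Base using (if_then_else_)
open import Data.Fin.Base using (Fin; toℕ; opposite; zero; suc)
open import Data.Fin.Permutation using (reverse)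
open import Data.Fin.Properties using (opposite-prop; opposite-involutive; toℕ<n; toℕ≤pred[n])
import Data.Integer.Base as ℤ
import Data.Integer.Properties as ℤ
open import Data.Nat.Base as ℕ using (ℕ; zero; suc; _∸_; _≤_; z≤n; s≤s)
open import Data.Nat.Combinatorics using (_C_; nCk+nC[k+1]≡[n+1]C[k+1]; k>n⇒nCk≡0)
open import Data.Nat.Divisibility
  using (_∣_; _∣?_; divides; _∣0; ∣-refl; ∣m∣n⇒∣m+n; ∣m+n∣m⇒∣n; ∣1⇒≡1)
import Data.Nat.Properties as ℕ
open import Data.Nat.Properties using (_≤?_)
open import Data.Product.Base using (_×_; _,_; ∃-syntax)
open import Data.Rational.Base as ℚ using (ℚ; 0ℚ; 1ℚ; ½; _+_; _*_; -_; _-_)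
import Data.Rational.Properties as ℚ
open import Data.Rational.Solver using (module +-*-Solver)
import Data.Rational.Unnormalised.Base as ℚᵘ
import Data.Rational.Unnormalised.Properties as ℚᵘ
open import Data.Sum.Base using (_⊎_; inj₁; inj₂; [_,_]′)
open import Data.Vec.Base using ([]; _∷_; _∷ʳ_; tabulate)
open import Data.Vec.Properties using (tabulate-cong)
open import Function.Base using (_∘_; _$_)
open import Relation.Binary.PropositionalEquality
  using (_≡_; _≢_; refl; sym; trans; cong; cong₂; subst; module ≡-Reasoning)
import Relation.Binary.Reasoning.Setoid as SetoidReasoning
open import Relation.Nullary.Decidable using (Dec; yes; no; does; _×-dec_)
open import Relation.Nullary.Negation using (¬_; contradiction)

open import Algebra.Definitions.RawSemiring
  (RawRing.rawSemiring ℚ.+-*-rawRing) using (_^_)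
open import Algebra.Properties.Group ℚ.+-0-group
  using (x∙y⁻¹≈ε⇒x≈y; inverseʳ-unique; identityʳ-unique)
open import Algebra.Properties.Semiring.Sum (CommutativeRing.semiring ℚ.+-*-commutativeRing)
  using (sum; sum-cong-≗; sum-replicate-zero; ∑-distrib-+; sum-permute)
open +-*-Solver using (solve; con; _:+_; _:*_; _:-_; :-_; _:=_)
open ≡-Reasoning

-- Rational arithmetic.

-- `fromℕ` normalises a fraction, a computation that is stuck on variables, so the identity is
-- checked on unnormalised rationals.
fromℕ-+ : ∀ m n → fromℕ (m ℕ.+ n) ≡ fromℕ m + fromℕ n
fromℕ-+ m n = ℚ.toℚᵘ-injective $ ℚᵘ.≃-trans (ℚ.toℚᵘ-fromℚᵘ (ℤ.+ (m ℕ.+ n) ℚᵘ./ 1)) $ ℚᵘ.≃-sym $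
  ℚᵘ.≃-trans (ℚ.toℚᵘ-homo-+ (fromℕ m) (fromℕ n)) $
  ℚᵘ.≃-trans (ℚᵘ.+-cong (ℚ.toℚᵘ-fromℚᵘ (ℤ.+ m ℚᵘ./ 1)) (ℚ.toℚᵘ-fromℚᵘ (ℤ.+ n ℚᵘ./ 1)))
  (ℚᵘ.*≡* (cong (ℤ._* ℤ.1ℤ) (cong₂ ℤ._+_ (ℤ.*-identityʳ (ℤ.+ m)) (ℤ.*-identityʳ (ℤ.+ n)))))

fromℕ-injective : ∀ {m n} → fromℕ m ≡ fromℕ n → m ≡ n
fromℕ-injective {m} {n} eq with ℚ.fromℚᵘ-injective {ℤ.+ m ℚᵘ./ 1} {ℤ.+ n ℚᵘ./ 1} eq
... | ℚᵘ.*≡* m*1≡n*1 = ℤ.+-injective (ℤ.*-cancelʳ-≡ (ℤ.+ m) (ℤ.+ n) ℤ.1ℤ m*1≡n*1)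

*-cancelˡ-zero : ∀ {p q} → p ≢ 0ℚ → p * q ≡ 0ℚ → q ≡ 0ℚ
*-cancelˡ-zero {p} {q} p≢0 pq≡0 = begin
  q                 ≡⟨ ℚ.*-identityˡ q ⟨
  1ℚ * q            ≡⟨ cong (_* q) (ℚ.*-inverseˡ p) ⟨
  (ℚ.1/ p * p) * q  ≡⟨ ℚ.*-assoc (ℚ.1/ p) p q ⟩
  ℚ.1/ p * (p * q)  ≡⟨ cong (ℚ.1/ p *_) pq≡0 ⟩
  ℚ.1/ p * 0ℚ       ≡⟨ ℚ.*-zeroʳ (ℚ.1/ p) ⟩
  0ℚ                ∎
  where instance _ = ℚ.≢-nonZero p≢0

-- Evaluation of homogeneous polynomials at rational points.

-- Polynomial identities are transported to values, where substitution is composition and the ring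
-- solver applies; `fromFun-injective` leads back to coefficients.
⟦_⟧ : ∀ {d} → HPoly d → ℚ → ℚ → ℚ
⟦_⟧ {zero}  (c ∷ []) x y = c
⟦_⟧ {suc d} (c ∷ q)  x y = c * y ^ suc d + x * ⟦ q ⟧ x y

⟦⟧-0ₚ : ∀ d x y → ⟦ 0ₚ {d} ⟧ x y ≡ 0ℚ
⟦⟧-0ₚ zero    x y = refl
⟦⟧-0ₚ (suc d) x y rewrite ⟦⟧-0ₚ d x y =
  solve 2 (λ x Y → con 0ℚ :* Y :+ x :* con 0ℚ := con 0ℚ) refl x (y ^ suc d)

⟦⟧-+ₚ : ∀ {d} (p q : HPoly d) x y → ⟦ p +ₚ q ⟧ x y ≡ ⟦ p ⟧ x y + ⟦ q ⟧ x y
⟦⟧-+ₚ {zero}  (c ∷ []) (c′ ∷ []) x y = refl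
⟦⟧-+ₚ {suc d} (c ∷ p) (c′ ∷ q) x y rewrite ⟦⟧-+ₚ p q x y =
  solve 6 (λ c c′ Y x p q → (c :+ c′) :* Y :+ x :* (p :+ q)
                          := (c :* Y :+ x :* p) :+ (c′ :* Y :+ x :* q))
    refl c c′ (y ^ suc d) x (⟦ p ⟧ x y) (⟦ q ⟧ x y)

⟦⟧-·ₚ : ∀ {d} c (p : HPoly d) x y → ⟦ c ·ₚ p ⟧ x y ≡ c * ⟦ p ⟧ x y
⟦⟧-·ₚ {zero}  c (e ∷ []) x y = refl
⟦⟧-·ₚ {suc d} c (e ∷ p)  x y rewrite ⟦⟧-·ₚ c p x y =
  solve 5 (λ c e Y x p → (c :* e) :* Y :+ x :* (c :* p) := c :* (e :* Y :+ x :* p))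
    refl c e (y ^ suc d) x (⟦ p ⟧ x y)

⟦⟧-neg : ∀ {d} (p : HPoly d) x y → ⟦ -ₚ p ⟧ x y ≡ - ⟦ p ⟧ x y
⟦⟧-neg {zero}  (e ∷ []) x y = refl
⟦⟧-neg {suc d} (e ∷ p)  x y rewrite ⟦⟧-neg p x y =
  solve 4 (λ e Y x p → (:- e) :* Y :+ x :* (:- p) := :- (e :* Y :+ x :* p))
    refl e (y ^ suc d) x (⟦ p ⟧ x y)

⟦⟧-minus : ∀ {d} (p q : HPoly d) x y → ⟦ p -ₚ q ⟧ x y ≡ ⟦ p ⟧ x y - ⟦ q ⟧ x y
⟦⟧-minus p q x y = trans (⟦⟧-+ₚ p (-ₚ q) x y) (cong (⟦ p ⟧ x y +_) (⟦⟧-neg q x y))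

⟦⟧-∷ʳ0 : ∀ {d} (p : HPoly d) x y → ⟦ p ∷ʳ 0ℚ ⟧ x y ≡ y * ⟦ p ⟧ x y
⟦⟧-∷ʳ0 {zero}  (c ∷ []) x y =
  solve 3 (λ c x y → c :* (y :* con 1ℚ) :+ x :* con 0ℚ := y :* c) refl c x y
⟦⟧-∷ʳ0 {suc d} (c ∷ p)  x y rewrite ⟦⟧-∷ʳ0 p x y =
  solve 5 (λ c x y Y p → c :* (y :* Y) :+ x :* (y :* p) := y :* (c :* Y :+ x :* p))
    refl c x y (y ^ suc d) (⟦ p ⟧ x y)

⟦⟧-*ₚ : ∀ {d} L (p : HPoly d) x y → ⟦ L *ₚ p ⟧ x y ≡ ⟦ L ⟧ x y * ⟦ p ⟧ x y
⟦⟧-*ₚ {d} (b ∷ a ∷ []) p x y = begin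
  ⟦ a ·ₚ (0ℚ ∷ p) +ₚ b ·ₚ (p ∷ʳ 0ℚ) ⟧ x y
    ≡⟨ ⟦⟧-+ₚ (a ·ₚ (0ℚ ∷ p)) (b ·ₚ (p ∷ʳ 0ℚ)) x y ⟩
  ⟦ a ·ₚ (0ℚ ∷ p) ⟧ x y + ⟦ b ·ₚ (p ∷ʳ 0ℚ) ⟧ x y
    ≡⟨ cong₂ _+_ (⟦⟧-·ₚ a (0ℚ ∷ p) x y) (trans (⟦⟧-·ₚ b (p ∷ʳ 0ℚ) x y) (cong (b *_) (⟦⟧-∷ʳ0 p x y))) ⟩
  a * (0ℚ * y ^ suc d + x * ⟦ p ⟧ x y) + b * (y * ⟦ p ⟧ x y)
    ≡⟨ solve 6 (λ a b x y Y p → a :* (con 0ℚ :* Y :+ x :* p) :+ b :* (y :* p)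
                             := (b :* (y :* con 1ℚ) :+ x :* a) :* p)
         refl a b x y (y ^ suc d) (⟦ p ⟧ x y) ⟩
  (b * y ^ 1 + x * a) * ⟦ p ⟧ x y ∎

⟦⟧-^ₚ : ∀ L d x y → ⟦ L ^ₚ d ⟧ x y ≡ ⟦ L ⟧ x y ^ d
⟦⟧-^ₚ L zero    x y = refl
⟦⟧-^ₚ L (suc d) x y = trans (⟦⟧-*ₚ L (L ^ₚ d) x y) (cong (⟦ L ⟧ x y *_) (⟦⟧-^ₚ L d x y))

⟦⟧-⟨⟩ : ∀ {d} (p : HPoly d) L M x y → ⟦ p ⟨ L , M ⟩ ⟧ x y ≡ ⟦ p ⟧ (⟦ L ⟧ x y) (⟦ M ⟧ x y)
⟦⟧-⟨⟩ {zero}  (c ∷ []) L M x y = refl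
⟦⟧-⟨⟩ {suc d} (c ∷ p)  L M x y = trans (⟦⟧-+ₚ (c ·ₚ (M ^ₚ suc d)) _ x y) (cong₂ _+_
  (trans (⟦⟧-·ₚ c (M ^ₚ suc d) x y) (cong (c *_) (⟦⟧-^ₚ M (suc d) x y)))
  (trans (⟦⟧-*ₚ L (p ⟨ L , M ⟩) x y) (cong (⟦ L ⟧ x y *_) (⟦⟧-⟨⟩ p L M x y))))

-- Polynomials given by coefficient sequences.

-- Coefficients form a sequence on all of `ℕ`, so that shifts and reflections need no bounds;
-- entries beyond `d` are ignored.
fromFun : ∀ d → (ℕ → ℚ) → HPoly d
fromFun d c = tabulate (c ∘ toℕ)

fromFun-cong : ∀ d {c e} → (∀ n → c n ≡ e n) → ∀ x y → ⟦ fromFun d c ⟧ x y ≡ ⟦ fromFun d e ⟧ x y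
fromFun-cong d c≡e x y = cong (λ (p : HPoly d) → ⟦ p ⟧ x y) (tabulate-cong (c≡e ∘ toℕ))

fromFun-+ : ∀ d c e x y →
  ⟦ fromFun d (λ n → c n + e n) ⟧ x y ≡ ⟦ fromFun d c ⟧ x y + ⟦ fromFun d e ⟧ x y
fromFun-+ zero    c e x y = refl
fromFun-+ (suc d) c e x y rewrite fromFun-+ d (c ∘ suc) (e ∘ suc) x y =
  solve 6 (λ c e Y x p q → (c :+ e) :* Y :+ x :* (p :+ q)
                        := (c :* Y :+ x :* p) :+ (e :* Y :+ x :* q))
    refl (c 0) (e 0) (y ^ suc d) x (⟦ fromFun d (c ∘ suc) ⟧ x y) (⟦ fromFun d (e ∘ suc) ⟧ x y)

fromFun-last : ∀ d c x y →
  ⟦ fromFun (suc d) c ⟧ x y ≡ y * ⟦ fromFun d c ⟧ x y + c (suc d) * x ^ suc d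
fromFun-last zero    c x y =
  solve 4 (λ c e x y → c :* (y :* con 1ℚ) :+ x :* e := y :* c :+ e :* (x :* con 1ℚ))
    refl (c 0) (c 1) x y
fromFun-last (suc d) c x y rewrite fromFun-last d (c ∘ suc) x y =
  solve 7 (λ c e x y X Y p → c :* (y :* Y) :+ x :* (y :* p :+ e :* X)
                          := y :* (c :* Y :+ x :* p) :+ e :* (x :* X))
    refl (c 0) (c (suc (suc d))) x y (x ^ suc d) (y ^ suc d) (⟦ fromFun d (c ∘ suc) ⟧ x y)

-- The parameter `t` is there for the induction: passing to `c ∘ suc` shifts the exponent of 2 by
-- one, which doubles `t`.
fromFun-dilate : ∀ d c t s x y →
  ⟦ fromFun d (λ n → (fromℕ (t ℕ.* 2 ℕ.^ n) - s) * c n) ⟧ x y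
    ≡ fromℕ t * ⟦ fromFun d c ⟧ (x + x) y - s * ⟦ fromFun d c ⟧ x y
fromFun-dilate zero    c t s x y rewrite ℕ.*-identityʳ t =
  solve 3 (λ t s c → (t :- s) :* c := t :* c :- s :* c) refl (fromℕ t) s (c 0)
fromFun-dilate (suc d) c t s x y = begin
  (fromℕ (t ℕ.* 1) - s) * c 0 * yᵈ
    + x * ⟦ fromFun d (λ n → (fromℕ (t ℕ.* (2 ℕ.* 2 ℕ.^ n)) - s) * c (suc n)) ⟧ x y
    ≡⟨ cong₂ (λ u p → (u - s) * c 0 * yᵈ + x * p) (cong fromℕ (ℕ.*-identityʳ t))
         (trans (fromFun-cong d (λ n → cong (λ u → (fromℕ u - s) * c (suc n))
                  (sym (ℕ.*-assoc t 2 (2 ℕ.^ n)))) x y)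
                (fromFun-dilate d (c ∘ suc) (t ℕ.* 2) s x y)) ⟩
  (fromℕ t - s) * c 0 * yᵈ + x * (fromℕ (t ℕ.* 2) * p′ - s * p)
    ≡⟨ cong (λ u → (fromℕ t - s) * c 0 * yᵈ + x * (u * p′ - s * p)) t*2≡t+t ⟩
  (fromℕ t - s) * c 0 * yᵈ + x * ((fromℕ t + fromℕ t) * p′ - s * p)
    ≡⟨ solve 7 (λ t s c Y x p p′ → (t :- s) :* c :* Y :+ x :* ((t :+ t) :* p′ :- s :* p)
         := t :* (c :* Y :+ (x :+ x) :* p′) :- s :* (c :* Y :+ x :* p))
         refl (fromℕ t) s (c 0) yᵈ x p p′ ⟩
  fromℕ t * (c 0 * yᵈ + (x + x) * p′) - s * (c 0 * yᵈ + x * p) ∎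
  where
  yᵈ p p′ : ℚ
  yᵈ  = y ^ suc d
  p  = ⟦ fromFun d (c ∘ suc) ⟧ x y
  p′ = ⟦ fromFun d (c ∘ suc) ⟧ (x + x) y

  t*2≡t+t : fromℕ (t ℕ.* 2) ≡ fromℕ t + fromℕ t
  t*2≡t+t = trans (cong fromℕ (trans (ℕ.*-comm t 2) (cong (t ℕ.+_) (ℕ.+-identityʳ t)))) (fromℕ-+ t t)

fromFun-zero : ∀ d c → (∀ {n} → n ≤ d → c n ≡ 0ℚ) → ∀ x y → ⟦ fromFun d c ⟧ x y ≡ 0ℚ
fromFun-zero zero    c c≡0 x y = c≡0 z≤n
fromFun-zero (suc d) c c≡0 x y rewrite c≡0 z≤n | fromFun-zero d (c ∘ suc) (c≡0 ∘ s≤s) x y =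
  solve 2 (λ x Y → con 0ℚ :* Y :+ x :* con 0ℚ := con 0ℚ) refl x (y ^ suc d)

1^n≡1 : ∀ n → 1ℚ ^ n ≡ 1ℚ
1^n≡1 zero    = refl
1^n≡1 (suc n) = trans (ℚ.*-identityˡ (1ℚ ^ n)) (1^n≡1 n)

-- The combination f(2X,Y) - 2ᵈ⁺¹ f(X,Y) has no term in Xᵈ⁺¹, which lowers the degree.
fromFun-injective : ∀ d c → (∀ x → ⟦ fromFun d c ⟧ x 1ℚ ≡ 0ℚ) → ∀ {n} → n ≤ d → c n ≡ 0ℚ
fromFun-injective zero    c f≡0 z≤n = f≡0 0ℚ
fromFun-injective (suc d) c f≡0 n≤d+1 =
  [ lower ∘ ℕ.≤-pred , (λ { refl → last }) ]′ (ℕ.m≤n⇒m<n∨m≡n n≤d+1)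
  where
  s : ℚ
  -- The factor `1` is the instance `t = 1` of `fromFun-dilate`; it is kept because `1 ℕ.* n` does
  -- not reduce to `n`.
  s = fromℕ (1 ℕ.* 2 ℕ.^ suc d)

  e : ℕ → ℚ
  e n = (fromℕ (1 ℕ.* 2 ℕ.^ n) - s) * c n

  e≡0 : ∀ x → ⟦ fromFun d e ⟧ x 1ℚ ≡ 0ℚ
  e≡0 x = begin
    ⟦ fromFun d e ⟧ x 1ℚ
      -- The added term is the top one of `e`, whose coefficient contains `s - s`.
      ≡⟨ solve 4 (λ p s c X → p := con 1ℚ :* p :+ (s :- s) :* c :* X) refl
           (⟦ fromFun d e ⟧ x 1ℚ) s (c (suc d)) (x ^ suc d) ⟩
    1ℚ * ⟦ fromFun d e ⟧ x 1ℚ + e (suc d) * x ^ suc d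
      ≡⟨ fromFun-last d e x 1ℚ ⟨
    ⟦ fromFun (suc d) e ⟧ x 1ℚ
      ≡⟨ fromFun-dilate (suc d) c 1 s x 1ℚ ⟩
    1ℚ * ⟦ fromFun (suc d) c ⟧ (x + x) 1ℚ - s * ⟦ fromFun (suc d) c ⟧ x 1ℚ
      ≡⟨ cong₂ (λ u v → 1ℚ * u - s * v) (f≡0 (x + x)) (f≡0 x) ⟩
    1ℚ * 0ℚ - s * 0ℚ
      ≡⟨ solve 1 (λ s → con 1ℚ :* con 0ℚ :- s :* con 0ℚ := con 0ℚ) refl s ⟩
    0ℚ ∎

  factor≢0 : ∀ {n} → n ≤ d → fromℕ (1 ℕ.* 2 ℕ.^ n) - s ≢ 0ℚ
  factor≢0 {n} n≤d eq = ℕ.<⇒≢ (ℕ.^-monoʳ-< 2 (s≤s (s≤s z≤n)) (s≤s n≤d))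
    (trans (sym (ℕ.*-identityˡ (2 ℕ.^ n))) (trans (fromℕ-injective
      (x∙y⁻¹≈ε⇒x≈y (fromℕ (1 ℕ.* 2 ℕ.^ n)) s eq)) (ℕ.*-identityˡ (2 ℕ.^ suc d))))

  lower : ∀ {n} → n ≤ d → c n ≡ 0ℚ
  lower n≤d = *-cancelˡ-zero (factor≢0 n≤d) (fromFun-injective d e e≡0 n≤d)

  -- With the lower coefficients gone, the value at (1,1) is the leading coefficient.
  last : c (suc d) ≡ 0ℚ
  last = begin
    c (suc d)
      ≡⟨ solve 1 (λ c → c := con 1ℚ :* con 0ℚ :+ c :* con 1ℚ) refl (c (suc d)) ⟩
    1ℚ * 0ℚ + c (suc d) * 1ℚ
      ≡⟨ cong₂ (λ u v → 1ℚ * u + c (suc d) * v) (fromFun-zero d c lower 1ℚ 1ℚ) (1^n≡1 (suc d)) ⟨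
    1ℚ * ⟦ fromFun d c ⟧ 1ℚ 1ℚ + c (suc d) * 1ℚ ^ suc d
      ≡⟨ fromFun-last d c 1ℚ 1ℚ ⟨
    ⟦ fromFun (suc d) c ⟧ 1ℚ 1ℚ
      ≡⟨ f≡0 1ℚ ⟩
    0ℚ ∎

-- Binomial generating polynomials.

-- Σ C(N,n) aₙ xⁿ yᴺ⁻ⁿ, by Pascal's rule; substitutions act on a without sums of binomial coefficients.
binomial : ℕ → (ℕ → ℚ) → ℚ → ℚ → ℚ
binomial zero    a x y = a 0
binomial (suc N) a x y = y * binomial N a x y + x * binomial N (a ∘ suc) x y

binomial-cong : ∀ N {a a′} → (∀ {n} → n ≤ N → a n ≡ a′ n) → ∀ x y → binomial N a x y ≡ binomial N a′ x y
binomial-cong zero    a≡a′ x y = a≡a′ z≤n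
binomial-cong (suc N) a≡a′ x y = cong₂ (λ u v → y * u + x * v)
  (binomial-cong N (a≡a′ ∘ ℕ.m≤n⇒m≤1+n) x y) (binomial-cong N (a≡a′ ∘ s≤s) x y)

binomial-+ : ∀ N a a′ x y →
  binomial N (λ n → a n + a′ n) x y ≡ binomial N a x y + binomial N a′ x y
binomial-+ zero    a a′ x y = refl
binomial-+ (suc N) a a′ x y
  rewrite binomial-+ N a a′ x y | binomial-+ N (a ∘ suc) (a′ ∘ suc) x y =
  solve 6 (λ x y g g′ h h′ → y :* (g :+ g′) :+ x :* (h :+ h′)
                          := (y :* g :+ x :* h) :+ (y :* g′ :+ x :* h′))
    refl x y (binomial N a x y) (binomial N a′ x y)
    (binomial N (a ∘ suc) x y) (binomial N (a′ ∘ suc) x y)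

binomial-neg : ∀ N a x y → binomial N (λ n → - a n) x y ≡ - binomial N a x y
binomial-neg zero    a x y = refl
binomial-neg (suc N) a x y rewrite binomial-neg N a x y | binomial-neg N (a ∘ suc) x y =
  solve 4 (λ x y g h → y :* (:- g) :+ x :* (:- h) := :- (y :* g :+ x :* h))
    refl x y (binomial N a x y) (binomial N (a ∘ suc) x y)

-- Pascal's rule splits each positive coefficient in two. The parts with `a (suc n)` give the
-- summand with factor `x`; the others, with the constant term, give the summand with factor `y`,
-- since the extra top entry carries C(N,N+1) = 0.
binomial-coefficients : ∀ N a x y →
  ⟦ fromFun N (λ n → fromℕ (N C n) * a n) ⟧ x y ≡ binomial N a x y
binomial-coefficients zero    a x y = ℚ.*-identityˡ (a 0)
binomial-coefficients (suc N) a x y = begin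
  c 0 * y ^ suc N + x * ⟦ fromFun N (λ n → fromℕ (suc N C suc n) * a (suc n)) ⟧ x y
    ≡⟨ cong (λ p → c 0 * y ^ suc N + x * p)
         (trans (fromFun-cong N pascal x y) (fromFun-+ N c⁺ (c ∘ suc) x y)) ⟩
  c 0 * y ^ suc N + x * (⟦ fromFun N c⁺ ⟧ x y + ⟦ fromFun N (c ∘ suc) ⟧ x y)
    ≡⟨ solve 5 (λ c Y x p q → c :* Y :+ x :* (p :+ q) := (c :* Y :+ x :* q) :+ x :* p)
         refl (c 0) (y ^ suc N) x (⟦ fromFun N c⁺ ⟧ x y) (⟦ fromFun N (c ∘ suc) ⟧ x y) ⟩
  ⟦ fromFun (suc N) c ⟧ x y + x * ⟦ fromFun N c⁺ ⟧ x y
    ≡⟨ cong (_+ x * ⟦ fromFun N c⁺ ⟧ x y) (fromFun-last N c x y) ⟩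
  y * ⟦ fromFun N c ⟧ x y + c (suc N) * x ^ suc N + x * ⟦ fromFun N c⁺ ⟧ x y
    ≡⟨ cong₂ (λ u v → y * ⟦ fromFun N c ⟧ x y + u * a (suc N) * x ^ suc N + x * v)
         (cong fromℕ (k>n⇒nCk≡0 (ℕ.n<1+n N))) (binomial-coefficients N (a ∘ suc) x y) ⟩
  y * ⟦ fromFun N c ⟧ x y + 0ℚ * a (suc N) * x ^ suc N + x * binomial N (a ∘ suc) x y
    ≡⟨ cong (_+ x * binomial N (a ∘ suc) x y)
         (trans (solve 4 (λ y p a X → y :* p :+ con 0ℚ :* a :* X := y :* p) refl
                  y (⟦ fromFun N c ⟧ x y) (a (suc N)) (x ^ suc N))
                (cong (y *_) (binomial-coefficients N a x y))) ⟩
  y * binomial N a x y + x * binomial N (a ∘ suc) x y ∎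
  where
  c c⁺ : ℕ → ℚ
  c  n = fromℕ (N C n) * a n
  c⁺ n = fromℕ (N C n) * a (suc n)

  pascal : ∀ n → fromℕ (suc N C suc n) * a (suc n) ≡ c⁺ n + c (suc n)
  pascal n = begin
    fromℕ (suc N C suc n) * a (suc n)
      ≡⟨ cong (λ m → fromℕ m * a (suc n)) (nCk+nC[k+1]≡[n+1]C[k+1] N n) ⟨
    fromℕ (N C n ℕ.+ N C suc n) * a (suc n)
      ≡⟨ cong (_* a (suc n)) (fromℕ-+ (N C n) (N C suc n)) ⟩
    (fromℕ (N C n) + fromℕ (N C suc n)) * a (suc n)
      ≡⟨ ℚ.*-distribʳ-+ (a (suc n)) (fromℕ (N C n)) (fromℕ (N C suc n)) ⟩
    c⁺ n + c (suc n) ∎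

nCk≢0 : ∀ {n k} → k ≤ n → n C k ≢ 0
nCk≢0 {n}     {zero}  z≤n       ()
nCk≢0 {suc n} {suc k} (s≤s k≤n) eq =
  nCk≢0 k≤n (ℕ.m+n≡0⇒m≡0 (n C k) (trans (nCk+nC[k+1]≡[n+1]C[k+1] n k) eq))

-- The values at `y = 1` already determine the products C(N,n) (aₙ - a′ₙ), and C(N,n) is nonzero for
-- n ≤ N.
binomial-injective : ∀ N a a′ → (∀ x y → binomial N a x y ≡ binomial N a′ x y) →
                     ∀ {n} → n ≤ N → a n ≡ a′ n
binomial-injective N a a′ g≡g′ {n} n≤N = x∙y⁻¹≈ε⇒x≈y (a n) (a′ n) $
  *-cancelˡ-zero (nCk≢0 n≤N ∘ fromℕ-injective)
    (fromFun-injective N (λ n → fromℕ (N C n) * (a n - a′ n)) vanishes n≤N)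
  where
  vanishes : ∀ x → ⟦ fromFun N (λ n → fromℕ (N C n) * (a n - a′ n)) ⟧ x 1ℚ ≡ 0ℚ
  vanishes x = begin
    ⟦ fromFun N (λ n → fromℕ (N C n) * (a n - a′ n)) ⟧ x 1ℚ
      ≡⟨ binomial-coefficients N (λ n → a n - a′ n) x 1ℚ ⟩
    binomial N (λ n → a n - a′ n) x 1ℚ
      ≡⟨ trans (binomial-+ N a (λ n → - a′ n) x 1ℚ)
           (cong₂ _+_ (g≡g′ x 1ℚ) (binomial-neg N a′ x 1ℚ)) ⟩
    binomial N a′ x 1ℚ - binomial N a′ x 1ℚ
      ≡⟨ ℚ.+-inverseʳ (binomial N a′ x 1ℚ) ⟩
    0ℚ ∎

binomial-swap : ∀ N a x y → binomial N a y x ≡ binomial N (λ n → a (N ∸ n)) x y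
binomial-swap zero    a x y = refl
binomial-swap (suc N) a x y = begin
  x * binomial N a y x + y * binomial N (a ∘ suc) y x
    ≡⟨ cong₂ (λ u v → x * u + y * v) (binomial-swap N a x y)
         (trans (binomial-swap N (a ∘ suc) x y)
                -- Truncated subtraction commutes with `suc` only for n ≤ N, which is why
                -- `binomial-cong` supplies this bound.
                (binomial-cong N (λ n≤N → cong a (sym (ℕ.+-∸-assoc 1 n≤N))) x y)) ⟩
  x * binomial N (λ n → a (N ∸ n)) x y + y * binomial N (λ n → a (suc N ∸ n)) x y
    ≡⟨ ℚ.+-comm (x * binomial N (λ n → a (N ∸ n)) x y) _ ⟩
  y * binomial N (λ n → a (suc N ∸ n)) x y + x * binomial N (λ n → a (N ∸ n)) x y ∎

binomial-01 : ∀ N a → binomial N a 0ℚ 1ℚ ≡ a 0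
binomial-01 zero    a = refl
binomial-01 (suc N) a = trans
  (solve 2 (λ g h → con 1ℚ :* g :+ con 0ℚ :* h := g) refl
    (binomial N a 0ℚ 1ℚ) (binomial N (a ∘ suc) 0ℚ 1ℚ))
  (binomial-01 N a)

-- Sign changes and the binomial transform.

sign : ℕ → ℚ
sign zero    = 1ℚ
sign (suc n) = - sign n

alternate : (ℕ → ℚ) → ℕ → ℚ
alternate a n = sign n * a n

binomial-alternate : ∀ N a x y → binomial N a (- x) y ≡ binomial N (alternate a) x y
binomial-alternate zero    a x y = sym (ℚ.*-identityˡ (a 0))
binomial-alternate (suc N) a x y = begin
  y * binomial N a (- x) y + - x * binomial N (a ∘ suc) (- x) y
    ≡⟨ cong₂ (λ u v → y * u + - x * v) (binomial-alternate N a x y) (binomial-alternate N (a ∘ suc) x y) ⟩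
  y * g + - x * binomial N (alternate (a ∘ suc)) x y
    ≡⟨ solve 4 (λ x y g h → y :* g :+ (:- x) :* h := y :* g :+ x :* (:- h))
         refl x y g (binomial N (alternate (a ∘ suc)) x y) ⟩
  y * g + x * - binomial N (alternate (a ∘ suc)) x y
    ≡⟨ cong (λ h → y * g + x * h) (trans (sym (binomial-neg N (alternate (a ∘ suc)) x y))
         (binomial-cong N (λ {n} _ → ℚ.neg-distribˡ-* (sign n) (a (suc n))) x y)) ⟩
  y * g + x * binomial N (alternate a ∘ suc) x y ∎
  where
  g : ℚ
  g = binomial N (alternate a) x y

-- This is the binomial transform Σᵢ C(n,i) aᵢ, as `transform-sum` confirms. The recursive form
-- matches what the substitution of `x + y` for `y` does to `binomial`.
transform : (ℕ → ℚ) → ℕ → ℚ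
transform a zero    = a 0
transform a (suc n) = transform a n + transform (a ∘ suc) n

binomial-transform : ∀ N a x y → binomial N a x (x + y) ≡ binomial N (transform a) x y
binomial-transform zero    a x y = refl
binomial-transform (suc N) a x y = begin
  (x + y) * binomial N a x (x + y) + x * binomial N (a ∘ suc) x (x + y)
    ≡⟨ cong₂ (λ u v → (x + y) * u + x * v)
         (binomial-transform N a x y) (binomial-transform N (a ∘ suc) x y) ⟩
  (x + y) * g + x * h
    ≡⟨ solve 4 (λ x y g h → (x :+ y) :* g :+ x :* h := y :* g :+ x :* (g :+ h)) refl x y g h ⟩
  y * g + x * (g + h)
    ≡⟨ cong (λ u → y * g + x * u) (binomial-+ N (transform a) (transform (a ∘ suc)) x y) ⟨
  y * g + x * binomial N (transform a ∘ suc) x y ∎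
  where
  g h : ℚ
  g = binomial N (transform a) x y
  h = binomial N (transform (a ∘ suc)) x y

-- Terms with i > n vanish, so any length `M` above `n` will do. The length is independent of `n`
-- because Pascal's rule leads to two sums with the same `n` but different lengths.
transform-sum : ∀ M a n → n ℕ.< M → sum {M} (λ i → a (toℕ i) * fromℕ (n C toℕ i)) ≡ transform a n
transform-sum (suc M) a zero    _     = begin
  a 0 * 1ℚ + sum {M} (λ i → a (suc (toℕ i)) * 0ℚ)
    ≡⟨ cong₂ _+_ (ℚ.*-identityʳ (a 0)) (trans
         (sum-cong-≗ {M} (λ i → ℚ.*-zeroʳ (a (suc (toℕ i))))) (sum-replicate-zero M)) ⟩
  a 0 + 0ℚ ≡⟨ ℚ.+-identityʳ (a 0) ⟩
  a 0      ∎
transform-sum (suc M) a (suc n) n+1<M = begin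
  a 0 * 1ℚ + sum {M} (λ i → a (suc (toℕ i)) * fromℕ (suc n C suc (toℕ i)))
    ≡⟨ cong (a 0 * 1ℚ +_) (trans (sum-cong-≗ {M} (pascal ∘ toℕ))
         (∑-distrib-+ {M} (s ∘ toℕ) (t ∘ toℕ))) ⟩
  a 0 * 1ℚ + (sum {M} (s ∘ toℕ) + sum {M} (t ∘ toℕ))
    ≡⟨ solve 3 (λ a s t → a :+ (s :+ t) := (a :+ t) :+ s) refl
         (a 0 * 1ℚ) (sum {M} (s ∘ toℕ)) (sum {M} (t ∘ toℕ)) ⟩
  (a 0 * 1ℚ + sum {M} (t ∘ toℕ)) + sum {M} (s ∘ toℕ)
    ≡⟨ cong₂ _+_ (transform-sum (suc M) a n (ℕ.<-trans (ℕ.n<1+n n) n+1<M))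
                 (transform-sum M (a ∘ suc) n (ℕ.≤-pred n+1<M)) ⟩
  transform a n + transform (a ∘ suc) n ∎
  where
  s t : ℕ → ℚ
  s i = a (suc i) * fromℕ (n C i)
  t i = a (suc i) * fromℕ (n C suc i)

  pascal : ∀ i → a (suc i) * fromℕ (suc n C suc i) ≡ s i + t i
  pascal i = begin
    a (suc i) * fromℕ (suc n C suc i)
      ≡⟨ cong (λ m → a (suc i) * fromℕ m) (nCk+nC[k+1]≡[n+1]C[k+1] n i) ⟨
    a (suc i) * fromℕ (n C i ℕ.+ n C suc i)
      ≡⟨ cong (a (suc i) *_) (fromℕ-+ (n C i) (n C suc i)) ⟩
    a (suc i) * (fromℕ (n C i) + fromℕ (n C suc i))
      ≡⟨ ℚ.*-distribˡ-+ (a (suc i)) (fromℕ (n C i)) (fromℕ (n C suc i)) ⟩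
    s i + t i ∎

-- Parity and signs.

sign-+ : ∀ m n → sign (m ℕ.+ n) ≡ sign m * sign n
sign-+ zero    n = sym (ℚ.*-identityˡ (sign n))
sign-+ (suc m) n = trans (cong -_ (sign-+ m n)) (ℚ.neg-distribˡ-* (sign m) (sign n))

sign-square : ∀ n → sign n * sign n ≡ 1ℚ
sign-square zero    = refl
sign-square (suc n) = trans (solve 1 (λ s → :- s :* :- s := s :* s) refl (sign n)) (sign-square n)

sign-even : ∀ {n} → 2 ∣ n → sign n ≡ 1ℚ
sign-even (divides q refl) = even q
  where
  even : ∀ q → sign (q ℕ.* 2) ≡ 1ℚ
  even zero    = refl
  even (suc q) = trans (solve 1 (λ s → :- (:- s) := s) refl (sign (q ℕ.* 2))) (even q)

sign-odd : ∀ {n} → 2 ∣ suc n → sign n ≡ - 1ℚ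
sign-odd {n} 2∣n+1 = trans (solve 1 (λ s → s := :- (:- s)) refl (sign n)) (cong -_ (sign-even 2∣n+1))

even-or-odd : ∀ n → 2 ∣ n ⊎ 2 ∣ suc n
even-or-odd zero    = inj₁ (2 ∣0)
even-or-odd (suc n) = [ inj₂ ∘ ∣m∣n⇒∣m+n ∣-refl , inj₁ ]′ (even-or-odd n)

2∤1 : ¬ 2 ∣ 1
2∤1 2∣1 with () ← ∣1⇒≡1 2∣1

2∣n⇒2∤1+n : ∀ {n} → 2 ∣ n → ¬ 2 ∣ suc n
2∣n⇒2∤1+n {n} 2∣n 2∣n+1 = 2∤1 (∣m+n∣m⇒∣n (subst (2 ∣_) (ℕ.+-comm 1 n) 2∣n+1) 2∣n)

-- The signs of `N ∸ n` and `n` multiply to that of the odd number `N`, and each sign is its own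
-- inverse.
sign-reflect : ∀ {N n} → 2 ∣ suc N → n ≤ N → sign (N ∸ n) ≡ - sign n
sign-reflect {N} {n} 2∣N+1 n≤N = begin
  s             ≡⟨ ℚ.*-identityʳ s ⟨
  s * 1ℚ        ≡⟨ cong (s *_) (sign-square n) ⟨
  s * (t * t)   ≡⟨ ℚ.*-assoc s t t ⟨
  s * t * t     ≡⟨ cong (_* t) (sign-+ (N ∸ n) n) ⟨
  sign (N ∸ n ℕ.+ n) * t
                ≡⟨ cong (λ m → sign m * t) (ℕ.m∸n+n≡m n≤N) ⟩
  sign N * t    ≡⟨ cong (_* t) (sign-odd 2∣N+1) ⟩
  - 1ℚ * t      ≡⟨ solve 1 (λ t → :- con 1ℚ :* t := :- t) refl t ⟩
  - t           ∎
  where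
  s t : ℚ
  s = sign (N ∸ n)
  t = sign n

-- Functional equations of even period polynomials.

⟦⟧-X : ∀ x y → ⟦ X ⟧ x y ≡ x
⟦⟧-X = solve 2 (λ x y → con 0ℚ :* (y :* con 1ℚ) :+ x :* con 1ℚ := x) refl

⟦⟧-Y : ∀ x y → ⟦ Y ⟧ x y ≡ y
⟦⟧-Y = solve 2 (λ x y → con 1ℚ :* (y :* con 1ℚ) :+ x :* con 0ℚ := y) refl

module EvenPeriodPolynomial {k} {p : V k} (W⁺p : W⁺ k p) where
  open W⁺ W⁺p
  open W inW

  p-symmetric : ∀ x y → ⟦ p ⟧ x y ≡ ⟦ p ⟧ y x
  p-symmetric x y = trans (cong (λ q → ⟦ q ⟧ x y) symmetric)
    (trans (⟦⟧-⟨⟩ p Y X x y) (cong₂ ⟦ p ⟧ (⟦⟧-Y x y) (⟦⟧-X x y)))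

  -- The two-term relation at (y,x) reads p(y,x) + p(-x,y) = 0; symmetry does the rest.
  p-oddˡ : ∀ x y → ⟦ p ⟧ (- x) y ≡ - ⟦ p ⟧ x y
  p-oddˡ x y = trans (inverseʳ-unique (⟦ p ⟧ y x) (⟦ p ⟧ (- x) y) (begin
    ⟦ p ⟧ y x + ⟦ p ⟧ (- x) y
      ≡⟨ cong (⟦ p ⟧ y x +_) (trans (⟦⟧-⟨⟩ p (-ₚ Y) X y x)
           (cong₂ ⟦ p ⟧ (trans (⟦⟧-neg Y y x) (cong -_ (⟦⟧-Y y x))) (⟦⟧-X y x))) ⟨
    ⟦ p ⟧ y x + ⟦ p ⟨ -ₚ Y , X ⟩ ⟧ y x
      ≡⟨ ⟦⟧-+ₚ p (p ⟨ -ₚ Y , X ⟩) y x ⟨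
    ⟦ p +ₚ p ⟨ -ₚ Y , X ⟩ ⟧ y x
      ≡⟨ trans (cong (λ q → ⟦ q ⟧ y x) two-term) (⟦⟧-0ₚ (k ∸ 2) y x) ⟩
    0ℚ ∎)) (cong -_ (p-symmetric y x))

  p-oddʳ : ∀ x y → ⟦ p ⟧ x (- y) ≡ - ⟦ p ⟧ x y
  p-oddʳ x y = trans (p-symmetric x (- y)) (trans (p-oddˡ y x) (cong -_ (p-symmetric y x)))

  p-three-term : ∀ x y → ⟦ p ⟧ x y + ⟦ p ⟧ (x - y) x + ⟦ p ⟧ y (y - x) ≡ 0ℚ
  p-three-term x y = begin
    ⟦ p ⟧ x y + ⟦ p ⟧ (x - y) x + ⟦ p ⟧ y (y - x)
      ≡⟨ cong₂ (λ u v → ⟦ p ⟧ x y + u + v)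
           (trans (⟦⟧-⟨⟩ p (X -ₚ Y) X x y) (cong₂ ⟦ p ⟧
             (trans (⟦⟧-minus X Y x y) (cong₂ _-_ (⟦⟧-X x y) (⟦⟧-Y x y))) (⟦⟧-X x y)))
           (trans (⟦⟧-⟨⟩ p Y (Y -ₚ X) x y) (cong₂ ⟦ p ⟧ (⟦⟧-Y x y)
             (trans (⟦⟧-minus Y X x y) (cong₂ _-_ (⟦⟧-Y x y) (⟦⟧-X x y))))) ⟨
    ⟦ p ⟧ x y + ⟦ p ⟨ X -ₚ Y , X ⟩ ⟧ x y + ⟦ p ⟨ Y , Y -ₚ X ⟩ ⟧ x y
      ≡⟨ trans (⟦⟧-+ₚ (p +ₚ p ⟨ X -ₚ Y , X ⟩) (p ⟨ Y , Y -ₚ X ⟩) x y)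
           (cong (_+ ⟦ p ⟨ Y , Y -ₚ X ⟩ ⟧ x y) (⟦⟧-+ₚ p (p ⟨ X -ₚ Y , X ⟩) x y)) ⟨
    ⟦ p +ₚ p ⟨ X -ₚ Y , X ⟩ +ₚ p ⟨ Y , Y -ₚ X ⟩ ⟧ x y
      ≡⟨ trans (cong (λ q → ⟦ q ⟧ x y) three-term) (⟦⟧-0ₚ (k ∸ 2) x y) ⟩
    0ℚ ∎

  -- The three-term relation at (x+y,y) is p(x+y,y) + p(x,x+y) + p(y,-x) = 0; symmetry and oddness
  -- rewrite the last two terms.
  p-split : ∀ x y → ⟦ p ⟧ x y ≡ ⟦ p ⟧ (x + y) y + ⟦ p ⟧ (x + y) x
  p-split x y = sym $ x∙y⁻¹≈ε⇒x≈y (⟦ p ⟧ (x + y) y + ⟦ p ⟧ (x + y) x) (⟦ p ⟧ x y) $ begin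
    ⟦ p ⟧ (x + y) y + ⟦ p ⟧ (x + y) x - ⟦ p ⟧ x y
      ≡⟨ cong₂ (λ u v → ⟦ p ⟧ (x + y) y + u + v) (p-symmetric (x + y) x)
           (trans (cong -_ (p-symmetric x y)) (sym (p-oddʳ y x))) ⟩
    ⟦ p ⟧ (x + y) y + ⟦ p ⟧ x (x + y) + ⟦ p ⟧ y (- x)
      ≡⟨ cong₂ (λ u v → ⟦ p ⟧ (x + y) y + ⟦ p ⟧ u (x + y) + ⟦ p ⟧ y v)
           (solve 2 (λ x y → x := x :+ y :- y) refl x y)
           (solve 2 (λ x y → :- x := y :- (x :+ y)) refl x y) ⟩
    ⟦ p ⟧ (x + y) y + ⟦ p ⟧ (x + y - y) (x + y) + ⟦ p ⟧ y (y - (x + y))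
      ≡⟨ p-three-term (x + y) y ⟩
    0ℚ ∎

  -- At (1,0) the splitting reads p(1,0) = p(1,0) + p(1,1).
  p-11 : ⟦ p ⟧ 1ℚ 1ℚ ≡ 0ℚ
  p-11 = identityʳ-unique (⟦ p ⟧ 1ℚ 0ℚ) (⟦ p ⟧ 1ℚ 1ℚ) (sym (p-split 1ℚ 0ℚ))

  -- `B` is the expansion defining the `b`, multiplied by `y` to turn the exponent s - 2 into s - 1;
  -- `A` generates the differences of the `b`.
  B A : ℚ → ℚ → ℚ
  B x y = y * ⟦ p ⟧ (x + y) y
  A x y = B x y - B y x

  -- The new arguments add up to `y`, so only p(y,x+y) = u and p(y,-x) = -p(x,y) = -(u + v) occur,
  -- and the multiples x u cancel.
  A-invariant : ∀ x y → A (- x) (x + y) ≡ A x y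
  A-invariant x y = begin
    (x + y) * ⟦ p ⟧ (- x + (x + y)) (x + y) - - x * ⟦ p ⟧ (x + y + - x) (- x)
      ≡⟨ cong₂ (λ u v → (x + y) * u - - x * v)
           (trans (cong (λ z → ⟦ p ⟧ z (x + y)) (solve 2 (λ x y → :- x :+ (x :+ y) := y) refl x y))
                  (p-symmetric y (x + y)))
           (trans (cong (λ z → ⟦ p ⟧ z (- x)) (solve 2 (λ x y → x :+ y :+ :- x := y) refl x y))
           (trans (p-oddʳ y x) (cong -_ (trans (p-symmetric y x) (p-split x y))))) ⟩
    (x + y) * u - - x * - (u + v)
      ≡⟨ solve 4 (λ x y u v → (x :+ y) :* u :- (:- x) :* (:- (u :+ v)) := y :* u :- x :* v) refl x y u v ⟩
    y * u - x * v
      ≡⟨ cong (λ z → y * u - x * ⟦ p ⟧ z x) (ℚ.+-comm x y) ⟩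
    y * u - x * ⟦ p ⟧ (y + x) x ∎
    where
    u v : ℚ
    u = ⟦ p ⟧ (x + y) y
    v = ⟦ p ⟧ (x + y) x

-- The coefficients of A.

module Coefficients {m} {p : V (2 ℕ.+ m)} (W⁺p : W⁺ (2 ℕ.+ m) p) (b : ℕ → ℕ → ℚ)
  (expansion : Y *ₚ p ⟨ X +ₚ Y , Y ⟩
    ≡ tabulate (λ ρ → fromℕ (suc m C toℕ ρ) * b (fst ρ) (snd ρ))) where

  open EvenPeriodPolynomial W⁺p

  N : ℕ
  N = suc m

  -- Pairs with r + s = k + 1 are indexed by n = r - 1 from 0 to `N`; exchanging r and s is n ↦ N -
  -- n.
  β a : ℕ → ℚ
  β n = b (suc n) (suc (N ∸ n))
  a n = β n - β (N ∸ n)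

  a-difference : (ρ : Fin (suc N)) → a (toℕ ρ) ≡ b (fst ρ) (snd ρ) - b (snd ρ) (fst ρ)
  a-difference ρ = cong₂ _-_
    (cong (b (fst ρ) ∘ suc) (sym (opposite-prop ρ)))
    (cong₂ b (cong suc (sym (opposite-prop ρ))) (cong suc (ℕ.m∸[m∸n]≡n (toℕ≤pred[n] ρ))))

  B-binomial : ∀ x y → B x y ≡ binomial N β x y
  B-binomial x y = begin
    y * ⟦ p ⟧ (x + y) y
      ≡⟨ cong₂ (λ u v → v * ⟦ p ⟧ u v)
           (trans (⟦⟧-+ₚ X Y x y) (cong₂ _+_ (⟦⟧-X x y) (⟦⟧-Y x y))) (⟦⟧-Y x y) ⟨
    ⟦ Y ⟧ x y * ⟦ p ⟧ (⟦ X +ₚ Y ⟧ x y) (⟦ Y ⟧ x y)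
      ≡⟨ trans (⟦⟧-*ₚ Y (p ⟨ X +ₚ Y , Y ⟩) x y)
           (cong (⟦ Y ⟧ x y *_) (⟦⟧-⟨⟩ p (X +ₚ Y) Y x y)) ⟨
    ⟦ Y *ₚ p ⟨ X +ₚ Y , Y ⟩ ⟧ x y
      ≡⟨ cong (λ q → ⟦ q ⟧ x y) (trans expansion (tabulate-cong λ ρ →
           cong (λ s → fromℕ (N C toℕ ρ) * b (fst ρ) (suc s)) (opposite-prop ρ))) ⟩
    ⟦ fromFun N (λ n → fromℕ (N C n) * β n) ⟧ x y
      ≡⟨ binomial-coefficients N β x y ⟩
    binomial N β x y ∎

  A-binomial : ∀ x y → A x y ≡ binomial N a x y
  A-binomial x y = sym (begin
    binomial N a x y
      ≡⟨ trans (binomial-+ N β (λ n → - β (N ∸ n)) x y)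
           (cong (binomial N β x y +_) (binomial-neg N (λ n → β (N ∸ n)) x y)) ⟩
    binomial N β x y - binomial N (λ n → β (N ∸ n)) x y
      ≡⟨ cong₂ _-_ (B-binomial x y) (trans (B-binomial y x) (binomial-swap N β x y)) ⟨
    B x y - B y x ∎)

  a-antisymmetric : ∀ {n} → n ≤ N → a (N ∸ n) ≡ - a n
  a-antisymmetric {n} n≤N = trans
    (cong (λ i → β (N ∸ n) - β i) (ℕ.m∸[m∸n]≡n n≤N))
    (solve 2 (λ u v → u :- v := :- (v :- u)) refl (β (N ∸ n)) (β n))

  -- This is `A-invariant` on coefficients: the sign change in `x` becomes `alternate`, the shear in
  -- `y` becomes `transform`.
  a-eigen : ∀ {n} → n ≤ N → transform (alternate a) n ≡ a n
  a-eigen = binomial-injective N (transform (alternate a)) a λ x y → begin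
    binomial N (transform (alternate a)) x y  ≡⟨ binomial-transform N (alternate a) x y ⟨
    binomial N (alternate a) x (x + y)        ≡⟨ binomial-alternate N a x (x + y) ⟨
    binomial N a (- x) (x + y)                ≡⟨ A-binomial (- x) (x + y) ⟨
    A (- x) (x + y)                           ≡⟨ A-invariant x y ⟩
    A x y                                     ≡⟨ A-binomial x y ⟩
    binomial N a x y                          ∎

  -- At (0,1) the binomial form collapses to `a 0`, while `A` reduces to p(1,1).
  a₀≡0 : a 0 ≡ 0ℚ
  a₀≡0 = begin
    a 0                                   ≡⟨ binomial-01 N a ⟨
    binomial N a 0ℚ 1ℚ                    ≡⟨ A-binomial 0ℚ 1ℚ ⟨
    1ℚ * ⟦ p ⟧ 1ℚ 1ℚ - 0ℚ * ⟦ p ⟧ 1ℚ 0ℚ   ≡⟨ solve 2 (λ u v → con 1ℚ :* u :- con 0ℚ :* v := u) refl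
                                               (⟦ p ⟧ 1ℚ 1ℚ) (⟦ p ⟧ 1ℚ 0ℚ) ⟩
    ⟦ p ⟧ 1ℚ 1ℚ                           ≡⟨ p-11 ⟩
    0ℚ                                    ∎

  -- For n = 1, `a-eigen` says a₀ - a₁ = a₁.
  a₁≡0 : a 1 ≡ 0ℚ
  a₁≡0 = begin
    a 1
      ≡⟨ solve 1 (λ u → u := con ½ :* (u :+ u)) refl (a 1) ⟩
    ½ * (a 1 + a 1)
      ≡⟨ cong (λ u → ½ * (a 1 + u)) (a-eigen (s≤s z≤n)) ⟨
    ½ * (a 1 + (1ℚ * a 0 + - 1ℚ * a 1))
      ≡⟨ cong (λ u → ½ * (a 1 + (1ℚ * u + - 1ℚ * a 1))) a₀≡0 ⟩
    ½ * (a 1 + (1ℚ * 0ℚ + - 1ℚ * a 1))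
      ≡⟨ solve 1 (λ u → con ½ :* (u :+ (con 1ℚ :* con 0ℚ :+ :- con 1ℚ :* u)) := con 0ℚ) refl (a 1) ⟩
    0ℚ ∎

  a-last≡0 : a N ≡ 0ℚ
  a-last≡0 = trans (a-antisymmetric z≤n) (cong -_ a₀≡0)

  -- The even r = n + 1 left out by the range are r = 2 and r = k, that is n = 1 and n = N.
  vanishes-outside : 2 ∣ suc N → ∀ {n} → n ≤ N → 2 ∣ suc n → ¬ (4 ≤ suc n × suc n ≤ m) → a n ≡ 0ℚ
  vanishes-outside 2∣N+1 {0} _ _ _ = a₀≡0
  vanishes-outside 2∣N+1 {1} _ _ _ = a₁≡0
  vanishes-outside 2∣N+1 {2} _ 2∣3 _ = contradiction 2∣3 (2∣n⇒2∤1+n ∣-refl)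
  vanishes-outside 2∣N+1 {suc (suc (suc n))} n≤N 2∣n+1 outside
    with ℕ.m≤n⇒m<n∨m≡n n≤N
  ... | inj₂ refl = a-last≡0
  ... | inj₁ (s≤s n≤m) with ℕ.m≤n⇒m<n∨m≡n n≤m
  ...   | inj₁ n<m  = contradiction (s≤s (s≤s (s≤s (s≤s z≤n))) , n<m) outside
  -- Here r = k - 1, which is odd.
  ...   | inj₂ refl = contradiction 2∣N+1 (2∣n⇒2∤1+n 2∣n+1)

-- Finite sums in modules.

module ModuleSum {r ℓr m ℓm} {R : CommutativeRing r ℓr} (M : Module R m ℓm) where
  open Module M
  open import Algebra.Properties.CommutativeMonoid.Sum +ᴹ-commutativeMonoid public
    using () renaming
    ( sum to sumᴹ; sum-cong-≋ to sumᴹ-cong; ∑-comm to sumᴹ-comm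
    ; ∑-distrib-+ to sumᴹ-distrib-+; sum-permute to sumᴹ-permute )
  private module R = CommutativeRing R
  open import Algebra.Properties.Semiring.Sum R.semiring using () renaming (sum to sumᴿ)

  *ₗ-sumᴹ : ∀ {n} c (f : Fin n → Carrierᴹ) → c *ₗ sumᴹ f ≈ᴹ sumᴹ (λ i → c *ₗ f i)
  *ₗ-sumᴹ {zero}  c f = *ₗ-zeroʳ c
  *ₗ-sumᴹ {suc n} c f = ≈ᴹ-trans (*ₗ-distribˡ c (f zero) _) (+ᴹ-cong ≈ᴹ-refl (*ₗ-sumᴹ c (f ∘ suc)))

  sumᴿ-*ₗ : ∀ {n} (f : Fin n → R.Carrier) z → sumᴿ f *ₗ z ≈ᴹ sumᴹ (λ i → f i *ₗ z)
  sumᴿ-*ₗ {zero}  f z = *ₗ-zeroˡ z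
  sumᴿ-*ₗ {suc n} f z = ≈ᴹ-trans (*ₗ-distribʳ z (f zero) _) (+ᴹ-cong ≈ᴹ-refl (sumᴿ-*ₗ (f ∘ suc) z))

-- Linear combinations of the double shuffle relations.

module Relations (n : ℕ) where
  open DoubleZeta (suc n)
  open Module 𝓓 using
    ( ≈ᴹ-setoid; ≈ᴹ-refl; ≈ᴹ-sym; ≈ᴹ-trans; ≈ᴹ-reflexive
    ; +ᴹ-group; +ᴹ-cong; *ₗ-distribˡ; *ₗ-distribʳ; *ₗ-assoc )
  -- `∑` and `sumᴹ` for `𝓓` are the same fold, so the general lemmas on sums apply to `∑` as they
  -- stand.
  open ModuleSum 𝓓
  open import Algebra.Properties.Group +ᴹ-group using (∙-cancelʳ; //-rightDividesˡ)

  private module S = SetoidReasoning ≈ᴹ-setoid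

  binomials : Fin n → Fin n → ℕ
  binomials i ρ = toℕ ρ C toℕ i ℕ.+ toℕ ρ C toℕ (opposite i)

  -- The generator `P i` is eliminated: adding `Zw` to the stuffle relation isolates it, and the
  -- shuffle relation replaces it.
  double-shuffle : ∀ i → ∑ (λ ρ → fromℕ (binomials i ρ) ⊛ Z ρ) ≈ᴹ (Z i ⊕ Z (opposite i)) ⊕ Zw
  double-shuffle i = ≈ᴹ-trans (rel (shuffle i)) (≈ᴹ-sym
    (≈ᴹ-trans (+ᴹ-cong (rel (stuffle i)) ≈ᴹ-refl) (//-rightDividesˡ Zw (P i))))

  module _ (u : Fin n → ℚ) where
    -- In the sum of the `double-shuffle` relations with weights `u`, these are the coefficients of
    -- `Z ρ` on the left and on the right.
    κ δ : Fin n → ℚ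
    κ ρ = sum λ i → u i * fromℕ (binomials i ρ)
    δ ρ = u ρ + u (opposite ρ)

    shuffle-side : ∑ (λ i → u i ⊛ ∑ (λ ρ → fromℕ (binomials i ρ) ⊛ Z ρ)) ≈ᴹ ∑ (λ ρ → κ ρ ⊛ Z ρ)
    shuffle-side = S.begin
      ∑ (λ i → u i ⊛ ∑ (λ ρ → fromℕ (binomials i ρ) ⊛ Z ρ))
        S.≈⟨ sumᴹ-cong (λ i → ≈ᴹ-trans (*ₗ-sumᴹ (u i) (λ ρ → fromℕ (binomials i ρ) ⊛ Z ρ))
              (sumᴹ-cong λ ρ → ≈ᴹ-sym (*ₗ-assoc (u i) (fromℕ (binomials i ρ)) (Z ρ)))) ⟩
      ∑ (λ i → ∑ (λ ρ → (u i * fromℕ (binomials i ρ)) ⊛ Z ρ))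
        S.≈⟨ sumᴹ-comm (λ i ρ → (u i * fromℕ (binomials i ρ)) ⊛ Z ρ) ⟩
      ∑ (λ ρ → ∑ (λ i → (u i * fromℕ (binomials i ρ)) ⊛ Z ρ))
        S.≈⟨ sumᴹ-cong (λ ρ → sumᴿ-*ₗ (λ i → u i * fromℕ (binomials i ρ)) (Z ρ)) ⟨
      ∑ (λ ρ → κ ρ ⊛ Z ρ) S.∎

    stuffle-side : ∑ (λ i → u i ⊛ ((Z i ⊕ Z (opposite i)) ⊕ Zw)) ≈ᴹ ∑ (λ ρ → δ ρ ⊛ Z ρ) ⊕ sum u ⊛ Zw
    stuffle-side = S.begin
      ∑ (λ i → u i ⊛ ((Z i ⊕ Z (opposite i)) ⊕ Zw))
        S.≈⟨ sumᴹ-cong (λ i → ≈ᴹ-trans (*ₗ-distribˡ (u i) (Z i ⊕ Z (opposite i)) Zw)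
              (+ᴹ-cong (*ₗ-distribˡ (u i) (Z i) (Z (opposite i))) ≈ᴹ-refl)) ⟩
      ∑ (λ i → (u i ⊛ Z i ⊕ u i ⊛ Z (opposite i)) ⊕ u i ⊛ Zw)
        S.≈⟨ ≈ᴹ-trans (sumᴹ-distrib-+ (λ i → u i ⊛ Z i ⊕ u i ⊛ Z (opposite i)) (λ i → u i ⊛ Zw))
              (+ᴹ-cong (sumᴹ-distrib-+ (λ i → u i ⊛ Z i) (λ i → u i ⊛ Z (opposite i)))
                       (≈ᴹ-sym (sumᴿ-*ₗ u Zw))) ⟩
      (∑ (λ i → u i ⊛ Z i) ⊕ ∑ (λ i → u i ⊛ Z (opposite i))) ⊕ sum u ⊛ Zw
        -- Reindexing by the involution `opposite` moves it from `Z` to the weights.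
        S.≈⟨ +ᴹ-cong (+ᴹ-cong ≈ᴹ-refl (≈ᴹ-trans
              (sumᴹ-permute (λ i → u i ⊛ Z (opposite i)) reverse)
              (sumᴹ-cong λ i → ≈ᴹ-reflexive
                (cong (λ j → u (opposite i) ⊛ Z j) (opposite-involutive i))))) ≈ᴹ-refl ⟩
      (∑ (λ i → u i ⊛ Z i) ⊕ ∑ (λ i → u (opposite i) ⊛ Z i)) ⊕ sum u ⊛ Zw
        S.≈⟨ +ᴹ-cong (≈ᴹ-trans (sumᴹ-cong (λ i → *ₗ-distribʳ (Z i) (u i) (u (opposite i))))
              (sumᴹ-distrib-+ (λ i → u i ⊛ Z i) (λ i → u (opposite i) ⊛ Z i))) ≈ᴹ-refl ⟨
      ∑ (λ ρ → δ ρ ⊛ Z ρ) ⊕ sum u ⊛ Zw S.∎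

    -- The weighted relations give Σ κ Z = Σ δ Z + (Σ u) Zw, and the common part Σ δ Z cancels.
    combination : (e : Fin n → ℚ) → (∀ ρ → e ρ + δ ρ ≡ κ ρ) → ∑ (λ ρ → e ρ ⊛ Z ρ) ≈ᴹ sum u ⊛ Zw
    combination e e+δ≡κ = ∙-cancelʳ (∑ λ ρ → δ ρ ⊛ Z ρ) _ _ (S.begin
      ∑ (λ ρ → e ρ ⊛ Z ρ) ⊕ ∑ (λ ρ → δ ρ ⊛ Z ρ)
        S.≈⟨ sumᴹ-distrib-+ (λ ρ → e ρ ⊛ Z ρ) (λ ρ → δ ρ ⊛ Z ρ) ⟨
      ∑ (λ ρ → e ρ ⊛ Z ρ ⊕ δ ρ ⊛ Z ρ)
        S.≈⟨ sumᴹ-cong (λ ρ → ≈ᴹ-trans (≈ᴹ-reflexive (cong (_⊛ Z ρ) (sym (e+δ≡κ ρ))))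
               (*ₗ-distribʳ (Z ρ) (e ρ) (δ ρ))) ⟨
      ∑ (λ ρ → κ ρ ⊛ Z ρ)
        S.≈⟨ shuffle-side ⟨
      ∑ (λ i → u i ⊛ ∑ (λ ρ → fromℕ (binomials i ρ) ⊛ Z ρ))
        S.≈⟨ sumᴹ-cong (λ i → ⊛-cong (u i) (double-shuffle i)) ⟩
      ∑ (λ i → u i ⊛ ((Z i ⊕ Z (opposite i)) ⊕ Zw))
        S.≈⟨ stuffle-side ⟩
      ∑ (λ ρ → δ ρ ⊛ Z ρ) ⊕ sum u ⊛ Zw
        S.≈⟨ ⊕-comm _ _ ⟩
      sum u ⊛ Zw ⊕ ∑ (λ ρ → δ ρ ⊛ Z ρ) S.∎)

  -- A condition on the index is traded for a coefficient that vanishes where the condition fails.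
  if-⊛ : ∀ {q} {Q : Set q} (Q? : Dec Q) {c d x} → (Q → d ≡ c) → (¬ Q → d ≡ 0ℚ) →
         (if does Q? then c ⊛ x else 𝟘) ≈ᴹ d ⊛ x
  if-⊛ (yes q) {x = x} d≡c _ = ≈ᴹ-reflexive (cong (_⊛ x) (sym (d≡c q)))
  if-⊛ (no ¬q) {x = x} _ d≡0 =
    ≈ᴹ-trans (≈ᴹ-sym (⊛-zeroˡ x)) (≈ᴹ-reflexive (cong (_⊛ x) (sym (d≡0 ¬q))))

-- The relation in weight k + 1.

¼ : ℚ
¼ = ½ * ½

theorem2 : (k : ℕ) → 12 ≤ k → 2 ∣ k →
    (p : V k) → W⁺ k p →
    (b : ℕ → ℕ → ℚ) →
    Y *ₚ p ⟨ X +ₚ Y , Y ⟩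
    ≡ tabulate (λ ρ → fromℕ ((k ∸ 1) C (fst ρ ∸ 1)) * b (fst ρ) (snd ρ)) →
    let open DoubleZeta (suc k) in
    ∃[ c ]
    (∑ λ (ρ : Index (suc k)) →
    if does ((4 ≤? fst ρ) ×-dec (fst ρ ≤? k ∸ 2) ×-dec (2 ∣? fst ρ))
    then (b (fst ρ) (snd ρ) - b (snd ρ) (fst ρ)) *ₗ Z ρ
    else 0ᴹ)
    ≈ᴹ c *ₗ Zw
-- Each double shuffle relation contains `Zw` once, so the weights add up to `sum u`; the quarter is
-- there because `e` is 4 a at even r.
theorem2 (suc (suc m)) (s≤s (s≤s _)) 2∣k p W⁺p b expansion = ¼ * sum u , (S.begin
  ∑ (λ ρ → if does (inRange? ρ) then (b (fst ρ) (snd ρ) - b (snd ρ) (fst ρ)) ⊛ Z ρ else 𝟘)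
    S.≈⟨ sumᴹ-cong summand ⟩
  ∑ (λ ρ → ¼ ⊛ (e ρ ⊛ Z ρ))
    S.≈⟨ *ₗ-sumᴹ ¼ (λ ρ → e ρ ⊛ Z ρ) ⟨
  ¼ ⊛ ∑ (λ ρ → e ρ ⊛ Z ρ)
    S.≈⟨ ⊛-cong ¼ (combination u e e+δ≡κ) ⟩
  ¼ ⊛ (sum u ⊛ Zw)
    S.≈⟨ ⊛-assoc ¼ (sum u) Zw ⟨
  (¼ * sum u) ⊛ Zw S.∎)
  where
  open Coefficients W⁺p b expansion
  open DoubleZeta (suc (suc (suc m)))
  open Module 𝓓 using (≈ᴹ-setoid)
  open ModuleSum 𝓓 using (sumᴹ-cong; *ₗ-sumᴹ)
  open Relations (suc N)
  module S = SetoidReasoning ≈ᴹ-setoid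

  -- `e` is κ - δ for these weights: `κ≡2a` gives 2 a, and `u-symmetric` gives δ = 2 u.
  u e : Fin (suc N) → ℚ
  u ρ = alternate a (toℕ ρ)
  e ρ = a (toℕ ρ) + a (toℕ ρ) - (u ρ + u ρ)

  -- Under n ↦ N - n both factors change sign, the first because `N` is odd.
  u-symmetric : ∀ ρ → u (opposite ρ) ≡ u ρ
  u-symmetric ρ = begin
    alternate a (toℕ (opposite ρ))  ≡⟨ cong (alternate a) (opposite-prop ρ) ⟩
    sign (N ∸ n) * a (N ∸ n)        ≡⟨ cong₂ _*_ (sign-reflect 2∣k n≤N) (a-antisymmetric n≤N) ⟩
    - sign n * - a n                ≡⟨ solve 2 (λ s a → (:- s) :* (:- a) := s :* a) refl (sign n) (a n) ⟩
    sign n * a n                    ∎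
    where
    n : ℕ
    n = toℕ ρ

    n≤N : n ≤ N
    n≤N = toℕ≤pred[n] ρ

  κ≡2a : ∀ ρ → κ u ρ ≡ a (toℕ ρ) + a (toℕ ρ)
  κ≡2a ρ = begin
    sum (λ i → u i * fromℕ (binomials i ρ))
      ≡⟨ sum-cong-≗ (λ i → trans (cong (u i *_) (fromℕ-+ (n C toℕ i) (n C toℕ (opposite i))))
           (ℚ.*-distribˡ-+ (u i) (fromℕ (n C toℕ i)) (fromℕ (n C toℕ (opposite i))))) ⟩
    sum (λ i → v i + u i * fromℕ (n C toℕ (opposite i)))
      ≡⟨ ∑-distrib-+ v (λ i → u i * fromℕ (n C toℕ (opposite i))) ⟩
    sum v + sum (λ i → u i * fromℕ (n C toℕ (opposite i)))
      -- As `u` is symmetric, reversal identifies the sums over the two binomials; each is a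
      -- transform evaluated by `a-eigen`.
      ≡⟨ cong (sum v +_) (trans (sum-permute v reverse) (sum-cong-≗ λ i →
           cong (_* fromℕ (n C toℕ (opposite i))) (u-symmetric i))) ⟨
    sum v + sum v
      ≡⟨ cong₂ _+_ sum-v sum-v ⟩
    a n + a n ∎
    where
    n : ℕ
    n = toℕ ρ

    v : Fin (suc N) → ℚ
    v i = u i * fromℕ (n C toℕ i)

    sum-v : sum v ≡ a n
    sum-v = trans (transform-sum (suc N) (alternate a) n (toℕ<n ρ)) (a-eigen (toℕ≤pred[n] ρ))

  e+δ≡κ : ∀ ρ → e ρ + δ u ρ ≡ κ u ρ
  e+δ≡κ ρ = begin
    e ρ + (u ρ + u (opposite ρ))  ≡⟨ cong (λ v → e ρ + (u ρ + v)) (u-symmetric ρ) ⟩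
    e ρ + (u ρ + u ρ)             ≡⟨ solve 2 (λ a u → (a :+ a :- (u :+ u)) :+ (u :+ u) := a :+ a)
                                       refl (a (toℕ ρ)) (u ρ) ⟩
    a (toℕ ρ) + a (toℕ ρ)         ≡⟨ κ≡2a ρ ⟨
    κ u ρ                         ∎

  inRange? : (ρ : Fin (suc N)) → Dec (4 ≤ fst ρ × fst ρ ≤ m × 2 ∣ fst ρ)
  inRange? ρ = (4 ≤? fst ρ) ×-dec (fst ρ ≤? m) ×-dec (2 ∣? fst ρ)

  -- Signs are indexed by n = r - 1, so even r carries the sign -1, and 2 a - 2 u becomes 4 a.
  ¼e-even : ∀ ρ → 2 ∣ fst ρ → ¼ * e ρ ≡ a (toℕ ρ)
  ¼e-even ρ 2∣r = trans
    (cong (λ s → ¼ * (a (toℕ ρ) + a (toℕ ρ) - (s * a (toℕ ρ) + s * a (toℕ ρ)))) (sign-odd 2∣r))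
    (solve 1 (λ a → con ¼ :* (a :+ a :- ((:- con 1ℚ) :* a :+ (:- con 1ℚ) :* a)) := a) refl (a (toℕ ρ)))

  ¼e-odd : ∀ ρ → 2 ∣ toℕ ρ → ¼ * e ρ ≡ 0ℚ
  ¼e-odd ρ 2∣n = trans
    (cong (λ s → ¼ * (a (toℕ ρ) + a (toℕ ρ) - (s * a (toℕ ρ) + s * a (toℕ ρ)))) (sign-even 2∣n))
    (solve 1 (λ a → con ¼ :* (a :+ a :- (con 1ℚ :* a :+ con 1ℚ :* a)) := con 0ℚ) refl (a (toℕ ρ)))

  -- For odd r the sign makes 2 a - 2 u cancel; for even r outside the range `a` itself is zero.
  ¼e-outside : ∀ ρ → ¬ (4 ≤ fst ρ × fst ρ ≤ m × 2 ∣ fst ρ) → ¼ * e ρ ≡ 0ℚ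
  ¼e-outside ρ outside with even-or-odd (toℕ ρ)
  ... | inj₁ 2∣n = ¼e-odd ρ 2∣n
  ... | inj₂ 2∣r = trans (¼e-even ρ 2∣r) (vanishes-outside 2∣k (toℕ≤pred[n] ρ) 2∣r
    λ (4≤r , r≤m) → outside (4≤r , r≤m , 2∣r))

  summand : ∀ ρ →
    (if does (inRange? ρ) then (b (fst ρ) (snd ρ) - b (snd ρ) (fst ρ)) ⊛ Z ρ else 𝟘)
      ≈ᴹ ¼ ⊛ (e ρ ⊛ Z ρ)
  summand ρ = ≈-trans
    (if-⊛ (inRange? ρ) (λ (_ , _ , 2∣r) → trans (¼e-even ρ 2∣r) (a-difference ρ)) (¼e-outside ρ))
    (⊛-assoc ¼ (e ρ) (Z ρ))
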